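{- For every integer $n \ge 1$, let $L(n)$ be the maximal (worst-case) number of comparisons used by the list-merging sort to sort $n$ elements. Then $L(n) \equiv 1 - m(n-1) \pmod 2$ for all $n \ge 1$.
   Context: For a non-negative integer $k$, $s_2(k)$ denotes the number of ones in the binary expansion of $k$. Define $\bar{t}(k) = 1$ if $s_2(k)$ is even and $\bar{t}(k)=0$ if $s_2(k)$ is odd. The sequence $m(n)$, $n \ge 0$, is defined by $m(2k) = \bar{t}(k)$ and $m(2k+1) = 0$ for all $k \ge 0$. List-merging sort: start with $n$ lists of size $1$, in a row. In each iteration, group the lists into consecutive pairs and merge the two lists in each pair; if the number of lists is odd, the last list is left unchanged. Thus after $k$ iterations (until a single list remains) there are lists of size $2^k$ and possibly one more (last) list of size at most $2^k$. Iterate until one list remains. Merging two sorted lists: compare the smallest elements of the two lists, remove the smaller one and put it next in the resulting list, and continue; when one list is exhausted the rest of the other is appended without comparisons. In the worst case, merging two non-empty lists with $N$ elements in total takes $N-1$ comparisons, and $L(n)$ is the sum of these worst-case counts over all merges performed. The sequence $L(n)$ is OEIS A003071, indexed from $n=1$: $0,1,3,5,9,11,14,17,25,27,30,33,38,\ldots$. -}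

module Defs where

open import Data.Bool.Base using (if_then_else_)
open import Data.Digit using (Bit; 1b; toDigits)
open import Data.Fin.Properties using () renaming (_≟_ to _≟ᶠ_)
open import Data.List.Base
  using (List; []; _∷_; length; filter; replicate; applyUpTo)
open import Data.Nat.Base using (ℕ; suc; _+_; _∸_; _/_; _<_; _≤_; z≤n; s≤s)
open import Data.Nat.Divisibility using (_∣?_)
open import Data.Nat.Induction using (Acc; acc; <-wellFounded)
open import Data.Nat.Properties using (m≤n⇒m≤1+n)
open import Data.Product.Base using (proj₁)
open import Relation.Binary.PropositionalEquality using (_≡_; refl)
open import Relation.Nullary.Decidable using (does)

binaryExpansion : ℕ → List Bit
binaryExpansion k = proj₁ (toDigits 2 k)

s₂ : ℕ → ℕ
s₂ k = length (filter (_≟ᶠ 1b) (binaryExpansion k))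

t̄ : ℕ → ℕ
t̄ k = if does (2 ∣? s₂ k) then 1 else 0

m : ℕ → ℕ
m n = if does (2 ∣? n) then t̄ (n / 2) else 0

-- In list-merging sort the pattern of merges depends only on the sizes of
-- the lists, so a state of the algorithm is the row of these sizes.

Row : Set
Row = List ℕ

-- The worst case for merging non-empty lists of sizes a and b. All lists
-- occurring in the sort are non-empty, so the subtraction is never truncated.

mergeComparisons : ℕ → ℕ → ℕ
mergeComparisons a b = (a + b) ∸ 1

mergePairs : Row → Row
mergePairs (a ∷ b ∷ r) = (a + b) ∷ mergePairs r
mergePairs r           = r

iterationComparisons : Row → ℕ
iterationComparisons (a ∷ b ∷ r) = mergeComparisons a b + iterationComparisons r
iterationComparisons _           = 0

length-mergePairs : ∀ r → length (mergePairs r) ≤ length r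
length-mergePairs []          = z≤n
length-mergePairs (a ∷ [])    = s≤s z≤n
length-mergePairs (a ∷ b ∷ r) = s≤s (m≤n⇒m≤1+n (length-mergePairs r))

mergePairs-shrinks : ∀ a b r →
  length (mergePairs (a ∷ b ∷ r)) < length (a ∷ b ∷ r)
mergePairs-shrinks a b r = s≤s (s≤s (length-mergePairs r))

totalComparisons : (r : Row) → Acc _<_ (length r) → ℕ
totalComparisons r@(a ∷ b ∷ r′) (acc rec) =
  iterationComparisons r +
  totalComparisons (mergePairs r) (rec (mergePairs-shrinks a b r′))
totalComparisons _ _ = 0

L : ℕ → ℕ
L n = totalComparisons (replicate n 1) (<-wellFounded _)

-- The initial terms of A003071.

L-initial : applyUpTo (λ i → L (suc i)) 13 ≡
  0 ∷ 1 ∷ 3 ∷ 5 ∷ 9 ∷ 11 ∷ 14 ∷ 17 ∷ 25 ∷ 27 ∷ 30 ∷ 33 ∷ 38 ∷ []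
L-initial = refl

m-initial : applyUpTo m 16 ≡
  1 ∷ 0 ∷ 0 ∷ 0 ∷ 0 ∷ 0 ∷ 1 ∷ 0 ∷ 0 ∷ 0 ∷ 1 ∷ 0 ∷ 1 ∷ 0 ∷ 0 ∷ 0 ∷ []
m-initial = refl

{-# OPTIONS --safe #-}

-- After the first iteration the row consists of q lists of a common even size
-- 2 ^ i followed by a last list of size d. An iteration merges ⌊ q / 2 ⌋ pairs
-- of equal lists, each at an odd cost, and if q is odd it also merges the last
-- list with its neighbour, at a cost of the parity of d + 1; the parity of d
-- itself never changes. By induction on the binary digits of q, the total is
-- congruent to q + d · s₂ q modulo 2. Writing n − 1 as 2q or 2q + 1, the first
-- iteration contributes q in both cases, up to an additional 1 in the second,
-- and leaves d = 1 respectively d = 2.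

module Submission where

open import Defs using (L; m; t̄; s₂; Row; binaryExpansion; mergePairs;
  iterationComparisons; totalComparisons; mergePairs-shrinks)
open import Data.Bool.Base using (if_then_else_)
open import Data.Digit using (Bit; 1b; fromDigits; toDigits)
open import Data.Fin.Base using (zero; suc)
open import Data.Fin.Properties using () renaming (_≟_ to _≟ᶠ_)
open import Data.Nat.Base using (ℕ; zero; suc; parity; _+_; _*_; _/_; _∸_; _<_; _≥_)
open import Data.Nat.Properties using (+-identityʳ)
import Data.Integer.Base as ℤ
open import Data.Integer.Base using (+_; _-_)
open import Data.Integer.Divisibility using (_∣_)
open import Data.Integer.Divisibility.Signed using (∣ᵤ⇒∣; ∣⇒∣ᵤ; ∣m∣n⇒∣m-n)
open import Data.Integer.Tactic.RingSolver using (solve-∀)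
open import Data.List.Base using (List; []; _∷_; _∷ʳ_; length; filter; replicate)
open import Data.Nat.Divisibility using (_∣?_; divides; divides-refl; ∣-refl) renaming (_∣_ to _∣ₙ_)
open import Data.Nat.DivMod using (_divMod_; result; m*n/n≡m)
open import Data.Nat.Induction using (Acc; acc; <-wellFounded)
open import Data.Parity.Base using (0ℙ; 1ℙ; _⁻¹) renaming (_+_ to _ℙ+_; _*_ to infixl 8 _ℙ*_)
open import Data.Parity.Properties as ℙ
  using (+-homo-+; *-homo-*; *-zeroʳ; p+p≡0ℙ; p+p⁻¹≡1ℙ; ⁻¹-involutive)
open import Data.Product.Base using (proj₂)
open import Function.Base using (_∘_)
open import Relation.Binary.PropositionalEquality
  using (_≡_; refl; sym; trans; cong; cong₂; subst; module ≡-Reasoning)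
open import Relation.Nullary.Decidable using (dec-true; dec-false)
open import Relation.Nullary.Negation using (¬_)

open ≡-Reasoning

-- Parity, divisibility by 2, and the values of `m`.

parity-suc : ∀ n → parity (suc n) ≡ parity n ⁻¹
parity-suc = +-homo-+ 1

parity-n*2 : ∀ n → parity (n * 2) ≡ 0ℙ
parity-n*2 n = trans (*-homo-* n 2) (*-zeroʳ (parity n))

parity-n+1+n : ∀ n → parity (n + suc n) ≡ 1ℙ
parity-n+1+n n = begin
  parity (n + suc n)          ≡⟨ +-homo-+ n (suc n) ⟩
  parity n ℙ+ parity (suc n)  ≡⟨ cong (parity n ℙ+_) (parity-suc n) ⟩
  parity n ℙ+ parity n ⁻¹     ≡⟨ p+p⁻¹≡1ℙ (parity n) ⟩
  1ℙ                          ∎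

2∣n⇒parity≡0 : ∀ {n} → 2 ∣ₙ n → parity n ≡ 0ℙ
2∣n⇒parity≡0 (divides-refl q) = parity-n*2 q

parity≡0⇒2∣n : ∀ n → parity n ≡ 0ℙ → 2 ∣ₙ n
parity≡0⇒2∣n n p with n divMod 2
... | result q zero       eq   = divides q eq
... | result q (suc zero) refl with trans (sym (parity-suc (q * 2))) p
...   | q*2-odd rewrite parity-n*2 q with () ← q*2-odd

parity≡1⇒2∤n : ∀ {n} → parity n ≡ 1ℙ → ¬ 2 ∣ₙ n
parity≡1⇒2∤n p 2∣n with () ← trans (sym p) (2∣n⇒parity≡0 2∣n)

parity-t̄ : ∀ q → parity (t̄ q) ≡ parity (s₂ q) ⁻¹
parity-t̄ q with parity (s₂ q) in eq
... | 0ℙ = cong (λ b → parity (if b then 1 else 0))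
             (dec-true (2 ∣? s₂ q) (parity≡0⇒2∣n (s₂ q) eq))
... | 1ℙ = cong (λ b → parity (if b then 1 else 0))
             (dec-false (2 ∣? s₂ q) (parity≡1⇒2∤n eq))

m-even : ∀ q → m (q * 2) ≡ t̄ q
m-even q = begin
  m (q * 2)      ≡⟨ cong (λ b → if b then t̄ (q * 2 / 2) else 0)
                      (dec-true (2 ∣? q * 2) (divides-refl q)) ⟩
  t̄ (q * 2 / 2)  ≡⟨ cong t̄ (m*n/n≡m q 2) ⟩
  t̄ q            ∎

m-odd : ∀ q → m (1 + q * 2) ≡ 0
m-odd q = cong (λ b → if b then t̄ ((1 + q * 2) / 2) else 0)
  (dec-false (2 ∣? 1 + q * 2)
    (parity≡1⇒2∤n (trans (parity-suc (q * 2)) (cong _⁻¹ (parity-n*2 q)))))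

-- The comparison count as a recursion on rows.

comparisons : Row → ℕ
comparisons r = totalComparisons r (<-wellFounded _)

-- Unfolding `comparisons` once leaves an accessibility proof that comes from `rec`, not from
-- `<-wellFounded`. Independence of that proof turns the unfolding into the recursion equation
-- `comparisons-step`.
totalComparisons-irrelevant : ∀ r (p q : Acc _<_ (length r)) →
  totalComparisons r p ≡ totalComparisons r q
totalComparisons-irrelevant []            p        q        = refl
totalComparisons-irrelevant (a ∷ [])      p        q        = refl
totalComparisons-irrelevant (a ∷ b ∷ r) (acc rs) (acc ss) =
  cong (_+_ (iterationComparisons (a ∷ b ∷ r)))
    (totalComparisons-irrelevant (mergePairs (a ∷ b ∷ r))
      (rs (mergePairs-shrinks a b r)) (ss (mergePairs-shrinks a b r)))

comparisons-step : ∀ r →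
  comparisons r ≡ iterationComparisons r + comparisons (mergePairs r)
comparisons-step []          = refl
comparisons-step (a ∷ [])    = refl
comparisons-step (a ∷ b ∷ r) = cong (_+_ (iterationComparisons (a ∷ b ∷ r)))
  (totalComparisons-irrelevant (mergePairs (a ∷ b ∷ r)) _ _)

-- Rows with a distinguished last list, and one iteration on them.

row : ℕ → ℕ → ℕ → Row
row q c d = replicate q c ∷ʳ d

-- Lets the initial row of ones enter as `row k 1 1`. Since `q` does not count the last list, `n`
-- elements give `k` = `n` - 1, the argument of `m`.
row-constant : ∀ q c → row q c c ≡ replicate (suc q) c
row-constant zero    c = refl
row-constant (suc q) c = cong (c ∷_) (row-constant q c)

mergePairs-even : ∀ q c d → mergePairs (row (q * 2) c d) ≡ row q (c + c) d
mergePairs-even zero    c d = refl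
mergePairs-even (suc q) c d = cong (c + c ∷_) (mergePairs-even q c d)

mergePairs-odd : ∀ q c d →
  mergePairs (row (1 + q * 2) c d) ≡ row q (c + c) (c + d)
mergePairs-odd zero    c d = refl
mergePairs-odd (suc q) c d = cong (c + c ∷_) (mergePairs-odd q c d)

-- Merging two lists of size suc c costs the odd number c + suc c.
parity-merge-equal : ∀ c x → parity (c + suc c + x) ≡ parity x ⁻¹
parity-merge-equal c x =
  trans (+-homo-+ (c + suc c) x) (cong (_ℙ+ parity x) (parity-n+1+n c))

-- The last list has no partner, so only the `q` odd costs count. Writing the size as `suc c` lets
-- the subtraction in `mergeComparisons` compute away.
parity-iteration-even : ∀ q c d →
  parity (iterationComparisons (row (q * 2) (suc c) d)) ≡ parity q
parity-iteration-even zero    c d = refl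
parity-iteration-even (suc q) c d = begin
  parity (c + suc c + x)  ≡⟨ parity-merge-equal c x ⟩
  parity x ⁻¹             ≡⟨ cong _⁻¹ (parity-iteration-even q c d) ⟩
  parity q ⁻¹             ≡⟨ parity-suc q ⟨
  parity (suc q)          ∎
  where x = iterationComparisons (row (q * 2) (suc c) d)

parity-iteration-odd : ∀ q c d →
  parity (iterationComparisons (row (1 + q * 2) (suc c) d)) ≡
  parity q ℙ+ parity (c + d)
parity-iteration-odd zero    c d = cong parity (+-identityʳ (c + d))
parity-iteration-odd (suc q) c d = begin
  parity (c + suc c + x)            ≡⟨ parity-merge-equal c x ⟩
  parity x ⁻¹                       ≡⟨ cong _⁻¹ (parity-iteration-odd q c d) ⟩
  (parity q ℙ+ parity (c + d)) ⁻¹   ≡⟨ ℙ.+-assoc 1ℙ (parity q) (parity (c + d)) ⟨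
  parity q ⁻¹ ℙ+ parity (c + d)     ≡⟨ cong (_ℙ+ parity (c + d)) (parity-suc q) ⟨
  parity (suc q) ℙ+ parity (c + d)  ∎
  where x = iterationComparisons (row (1 + q * 2) (suc c) d)

parity-comparisons-even : ∀ q c d →
  parity (comparisons (row (q * 2) (suc c) d)) ≡
  parity q ℙ+ parity (comparisons (row q (suc c + suc c) d))
parity-comparisons-even q c d = begin
  parity (comparisons r)
    ≡⟨ cong parity (comparisons-step r) ⟩
  parity (iterationComparisons r + comparisons (mergePairs r))
    ≡⟨ +-homo-+ (iterationComparisons r) _ ⟩
  parity (iterationComparisons r) ℙ+ parity (comparisons (mergePairs r))
    ≡⟨ cong₂ _ℙ+_ (parity-iteration-even q c d)
         (cong (parity ∘ comparisons) (mergePairs-even q (suc c) d)) ⟩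
  parity q ℙ+ parity (comparisons (row q (suc c + suc c) d))
    ∎
  where r = row (q * 2) (suc c) d

parity-comparisons-odd : ∀ q c d →
  parity (comparisons (row (1 + q * 2) (suc c) d)) ≡
  parity q ℙ+ parity (c + d) ℙ+ parity (comparisons (row q (suc c + suc c) (suc c + d)))
parity-comparisons-odd q c d = begin
  parity (comparisons r)
    ≡⟨ cong parity (comparisons-step r) ⟩
  parity (iterationComparisons r + comparisons (mergePairs r))
    ≡⟨ +-homo-+ (iterationComparisons r) _ ⟩
  parity (iterationComparisons r) ℙ+ parity (comparisons (mergePairs r))
    ≡⟨ cong₂ _ℙ+_ (parity-iteration-odd q c d)
         (cong (parity ∘ comparisons) (mergePairs-odd q (suc c) d)) ⟩
  parity q ℙ+ parity (c + d) ℙ+ parity (comparisons (row q (suc c + suc c) (suc c + d)))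
    ∎
  where r = row (1 + q * 2) (suc c) d

-- Induction on the binary digits of the row length.

ones : List Bit → ℕ
ones = length ∘ filter (_≟ᶠ 1b)

-- Digits come least significant first, so removing the head of `ds` matches one iteration. Both `c`
-- and `d` vary in the induction: sizes double, and a digit one enlarges the last list.
parity-comparisons-digits : ∀ ds c d → parity c ≡ 1ℙ →
  parity (comparisons (row (fromDigits ds) (suc c) d)) ≡
  parity (fromDigits ds) ℙ+ parity d ℙ* parity (ones ds)
parity-comparisons-digits []           c d c-odd = sym (*-zeroʳ (parity d))
parity-comparisons-digits (zero ∷ ds)  c d c-odd = begin
  parity (comparisons (row (q * 2) (suc c) d))
    ≡⟨ parity-comparisons-even q c d ⟩
  parity q ℙ+ parity (comparisons (row q (suc c + suc c) d))
    -- The doubled size `suc c + suc c` computes to `suc (c + suc c)`, and `c + suc c` is odd, so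
    -- the hypothesis on `c` is restored.
    ≡⟨ cong (parity q ℙ+_) (parity-comparisons-digits ds (c + suc c) d (parity-n+1+n c)) ⟩
  parity q ℙ+ (parity q ℙ+ e)
    ≡⟨ ℙ.+-assoc (parity q) (parity q) e ⟨
  parity q ℙ+ parity q ℙ+ e
    ≡⟨ cong (_ℙ+ e) (trans (p+p≡0ℙ (parity q)) (sym (parity-n*2 q))) ⟩
  parity (q * 2) ℙ+ e
    ∎
  where
  q = fromDigits ds
  e = parity d ℙ* parity (ones ds)
parity-comparisons-digits (suc zero ∷ ds) c d c-odd = begin
  parity (comparisons (row (1 + q * 2) (suc c) d))
    ≡⟨ parity-comparisons-odd q c d ⟩
  parity q ℙ+ parity (c + d) ℙ+ parity (comparisons (row q (suc c + suc c) (suc c + d)))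
    ≡⟨ cong (parity q ℙ+ parity (c + d) ℙ+_)
         (parity-comparisons-digits ds (c + suc c) (suc c + d) (parity-n+1+n c)) ⟩
  parity q ℙ+ parity (c + d) ℙ+ (parity q ℙ+ parity (suc c + d) ℙ* s)
    -- As `c` is odd, the cost `c + d` of the last merge flips the parity of `d`, while the new size
    -- `suc c + d` keeps it.
    ≡⟨ cong₂ (λ x y → parity q ℙ+ x ℙ+ (parity q ℙ+ y ℙ* s)) c+d-parity 1+c+d-parity ⟩
  parity q ℙ+ parity d ⁻¹ ℙ+ (parity q ℙ+ parity d ℙ* s)
    ≡⟨ cancel (parity q) (parity d) s ⟩
  1ℙ ℙ+ parity d ℙ* (s ⁻¹)
    ≡⟨ cong₂ (λ x y → x ℙ+ parity d ℙ* y)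
         (trans (parity-suc (q * 2)) (cong _⁻¹ (parity-n*2 q))) (parity-suc (ones ds)) ⟨
  parity (1 + q * 2) ℙ+ parity d ℙ* parity (suc (ones ds))
    ∎
  where
  q = fromDigits ds
  s = parity (ones ds)
  c+d-parity : parity (c + d) ≡ parity d ⁻¹
  c+d-parity = trans (+-homo-+ c d) (cong (_ℙ+ parity d) c-odd)
  1+c+d-parity : parity (suc c + d) ≡ parity d
  1+c+d-parity = trans (parity-suc (c + d))
    (trans (cong _⁻¹ c+d-parity) (⁻¹-involutive (parity d)))
  -- The two `p` cancel. Of `x ⁻¹` = 1 + `x`, the 1 is the parity of `1 + q * 2` and the `x` is the
  -- contribution of the new digit one.
  cancel : ∀ p x y → p ℙ+ x ⁻¹ ℙ+ (p ℙ+ x ℙ* y) ≡ 1ℙ ℙ+ x ℙ* (y ⁻¹)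
  cancel 0ℙ 0ℙ y  = refl
  cancel 0ℙ 1ℙ y  = sym (⁻¹-involutive y)
  cancel 1ℙ 0ℙ y  = refl
  cancel 1ℙ 1ℙ y  = refl

parity-comparisons : ∀ q c d → parity c ≡ 1ℙ →
  parity (comparisons (row q (suc c) d)) ≡ parity q ℙ+ parity d ℙ* parity (s₂ q)
parity-comparisons q c d c-odd =
  -- Only the row length is transported: `s₂ q` is already `ones (binaryExpansion q)` by definition.
  subst (λ k → parity (comparisons (row k (suc c) d)) ≡
               parity k ℙ+ parity d ℙ* parity (s₂ q))
    (proj₂ (toDigits 2 q)) (parity-comparisons-digits (binaryExpansion q) c d c-odd)

-- The parity of `L` and the comparison with `m`.

L-suc : ∀ k → L (suc k) ≡ comparisons (row k 1 1)
L-suc k = cong comparisons (sym (row-constant k 1))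

-- The first iteration is split off because the initial size 1 is odd; afterwards the size is 2,
-- that is `c` = 1. The last list keeps size 1, so the digit sum survives.
parity-L-even : ∀ q → parity (L (suc (q * 2))) ≡ parity (s₂ q)
parity-L-even q = begin
  parity (L (suc (q * 2)))                      ≡⟨ cong parity (L-suc (q * 2)) ⟩
  parity (comparisons (row (q * 2) 1 1))        ≡⟨ parity-comparisons-even q 0 1 ⟩
  parity q ℙ+ parity (comparisons (row q 2 1))  ≡⟨ cong (parity q ℙ+_) (parity-comparisons q 1 1 refl) ⟩
  parity q ℙ+ (parity q ℙ+ parity (s₂ q))       ≡⟨ ℙ.+-assoc (parity q) (parity q) _ ⟨
  parity q ℙ+ parity q ℙ+ parity (s₂ q)         ≡⟨ cong (_ℙ+ parity (s₂ q)) (p+p≡0ℙ (parity q)) ⟩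
  parity (s₂ q)                                 ∎

-- Here the last list has the even size 2 after the first iteration, which kills the digit sum.
parity-L-odd : ∀ q → parity (L (2 + q * 2)) ≡ 1ℙ
parity-L-odd q = begin
  parity (L (2 + q * 2))                              ≡⟨ cong parity (L-suc (1 + q * 2)) ⟩
  parity (comparisons (row (1 + q * 2) 1 1))          ≡⟨ parity-comparisons-odd q 0 1 ⟩
  parity q ℙ+ 1ℙ ℙ+ parity (comparisons (row q 2 2))  ≡⟨ cong (parity q ℙ+ 1ℙ ℙ+_) (parity-comparisons q 1 2 refl) ⟩
  parity q ℙ+ 1ℙ ℙ+ (parity q ℙ+ 0ℙ)                  ≡⟨ cancel (parity q) ⟩
  1ℙ                                                  ∎
  where
  cancel : ∀ p → p ℙ+ 1ℙ ℙ+ (p ℙ+ 0ℙ) ≡ 1ℙ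
  cancel 0ℙ = refl
  cancel 1ℙ = refl

parity-L+m : ∀ k → parity (L (suc k) + m k) ≡ 1ℙ
parity-L+m k with k divMod 2
... | result q zero refl = begin
  parity (L (suc (q * 2)) + m (q * 2))           ≡⟨ +-homo-+ (L (suc (q * 2))) _ ⟩
  parity (L (suc (q * 2))) ℙ+ parity (m (q * 2)) ≡⟨ cong₂ _ℙ+_ (parity-L-even q)
                                                      (trans (cong parity (m-even q)) (parity-t̄ q)) ⟩
  parity (s₂ q) ℙ+ parity (s₂ q) ⁻¹              ≡⟨ p+p⁻¹≡1ℙ (parity (s₂ q)) ⟩
  1ℙ                                             ∎
... | result q (suc zero) refl = begin
  parity (L (2 + q * 2) + m (1 + q * 2))           ≡⟨ +-homo-+ (L (2 + q * 2)) _ ⟩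
  parity (L (2 + q * 2)) ℙ+ parity (m (1 + q * 2)) ≡⟨ cong₂ _ℙ+_ (parity-L-odd q)
                                                        (cong parity (m-odd q)) ⟩
  1ℙ                                               ∎

-- For natural `a` and `b`, the term 1 + `a` + `b` is natural too, so its evenness can be settled by
-- `parity`.
a-[1-b]≡[1+a+b]-2 : ∀ a b → a - (+ 1 - b) ≡ (+ 1 ℤ.+ (a ℤ.+ b)) - + 2
a-[1-b]≡[1+a+b]-2 = solve-∀

lemma10 : (n : ℕ) → n ≥ 1 → + 2 ∣ (+ L n - (+ 1 - + m (n ∸ 1)))
lemma10 (suc k) _ = subst (+ 2 ∣_) (sym (a-[1-b]≡[1+a+b]-2 (+ L (suc k)) (+ m k)))
  -- The subtraction rule is one for signed divisibility, whereas the goal and the natural-number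
  -- facts concern absolute values; hence the conversions both ways.
  (∣⇒∣ᵤ (∣m∣n⇒∣m-n (∣ᵤ⇒∣ {+ 2} {+ suc (L (suc k) + m k)} 2∣1+L+m) (∣ᵤ⇒∣ {+ 2} {+ 2} ∣-refl)))
  where
  2∣1+L+m : 2 ∣ₙ suc (L (suc k) + m k)
  2∣1+L+m = parity≡0⇒2∣n _
    (trans (parity-suc (L (suc k) + m k)) (cong _⁻¹ (parity-L+m k)))
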